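{- Let $n, k, \ell$ be integers with $k \geq \ell \geq 2$ and $n \geq k + \ell$. Let $\mathcal F \subset \binom{[n]}{k}$ and $\mathcal G \subset \binom{[n]}{\ell}$ be non-trivial, shifted and cross-intersecting. Then $$|\mathcal F| + |\mathcal G| \leq \sum_{2 \leq i \leq \ell+1} \binom{\ell+1}{i}\binom{n-\ell-1}{k-i} + \binom{\ell+1}{\ell}.$$
   Context: $[n] = \{1,\dots,n\}$ and $\binom{[n]}{m}$ is the collection of $m$-element subsets of $[n]$; $\binom{a}{b} = 0$ if $b<0$ or $b > a$. Families $\mathcal F, \mathcal G$ are cross-intersecting if $F \cap G \neq \emptyset$ for all $F \in \mathcal F$, $G \in \mathcal G$. A family $\mathcal F$ is non-trivial if $\bigcap_{F \in \mathcal F} F = \emptyset$. For $m$-sets $A = \{x_1<\dots<x_m\}$ and $B = \{y_1<\dots<y_m\}$ write $A \prec B$ if $x_i \leq y_i$ for all $i$. A family $\mathcal H \subset \binom{[n]}{m}$ is shifted (initial) if $A \prec B$ and $B \in \mathcal H$ imply $A \in \mathcal H$. -}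

module Defs where

open import Data.Nat using (ℕ; zero; suc; _+_; _*_; _∸_; _≤ᵇ_)
open import Data.Nat.Combinatorics using (_C_)
open import Data.Bool using (Bool; true; false; if_then_else_)
open import Data.Fin using (Fin) renaming (zero to fzero; suc to fsuc; _≤_ to _≤ᶠ_)
open import Data.Fin.Subset using (Subset; ∣_∣; _∩_; Nonempty; _∉_)
open import Data.Vec using ([]; _∷_)
open import Data.List using (List; []; _∷_; map; _++_; upTo)
open import Data.Nat.ListAction using (sum)
open import Data.List.Relation.Binary.Pointwise using (Pointwise)
open import Data.Product using (Σ; _×_; ∃)
open import Relation.Binary.PropositionalEquality using (_≡_)

Family : ℕ → Set
Family n = Subset n → Bool

allSubsets : (n : ℕ) → List (Subset n)
allSubsets zero = [] ∷ []
allSubsets (suc n) = map (true ∷_) (allSubsets n) ++ map (false ∷_) (allSubsets n)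

card : ∀ {n} → Family n → ℕ
card {n} F = sum (map (λ s → if F s then 1 else 0) (allSubsets n))

Uniform : ∀ {n} → ℕ → Family n → Set
Uniform m F = ∀ A → F A ≡ true → ∣ A ∣ ≡ m

elems : ∀ {n} → Subset n → List (Fin n)
elems [] = []
elems (true ∷ p) = fzero ∷ map fsuc (elems p)
elems (false ∷ p) = map fsuc (elems p)

-- A ≺ B : x_i ≤ y_i for all i (for m-sets; Pointwise forces equal size)
_≺_ : ∀ {n} → Subset n → Subset n → Set
A ≺ B = Pointwise _≤ᶠ_ (elems A) (elems B)

Shifted : ∀ {n} → ℕ → Family n → Set
Shifted m H = ∀ A B → ∣ A ∣ ≡ m → ∣ B ∣ ≡ m → A ≺ B → H B ≡ true → H A ≡ true

CrossIntersecting : ∀ {n} → Family n → Family n → Set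
CrossIntersecting F G = ∀ A B → F A ≡ true → G B ≡ true → Nonempty (A ∩ B)

NonTrivial : ∀ {n} → Family n → Set
NonTrivial F = ∀ x → ∃ λ A → F A ≡ true × x ∉ A

-- binomial with the convention binom(a, b) = 0 for b < 0, b given as k - i
-- binomSub a k i = binom(a, k - i)  (0 when i > k)
binomSub : ℕ → ℕ → ℕ → ℕ
binomSub a k i = if i ≤ᵇ k then a C (k ∸ i) else 0

bound : ℕ → ℕ → ℕ → ℕ
bound n k ℓ =
  sum (map (λ j → ((ℓ + 1) C (j + 2)) * binomSub (n ∸ ℓ ∸ 1) k (j + 2)) (upTo ℓ))
  + ((ℓ + 1) C ℓ)

{-# OPTIONS --safe #-}
module Submission where

-- By shiftedness, non-triviality of G puts [2, ℓ+1] into G, and cross-intersection then makes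
-- every member of F meet [ℓ+1] at least twice; symmetrically every member of G meets [k+1]
-- twice. Only this is used from non-triviality, so that one can induct on n ≥ k + ℓ.
-- For n = k + ℓ, complementation gives |F| + |G| ≤ C(n, k), which equals the bound.
-- For n > k + ℓ, split both families by the last element. The members avoiding it are covered by
-- the induction hypothesis. The links F(n), G(n) are again cross-intersecting, since in a disjoint
-- pair of them the element n of one set could be shifted to a point outside both; they satisfy
-- |F(n)| + |G(n)| ≤ #{(k-1)-sets meeting [ℓ+1] twice}, by a second induction of the same shape
-- whose base case is again complementation: the complement of an (ℓ-1)-set contains
-- at least two points of [ℓ+1].

open import Defs
open import Algebra.Properties.CommutativeSemigroup using (interchange)
open import Data.Bool using (Bool; true; false; if_then_else_)
open import Data.Empty using (⊥-elim)
open import Data.Fin using () renaming (zero to fzero; suc to fsuc)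
import Data.Fin.Properties as Fin
open import Data.Fin.Subset using (Subset; ∣_∣; _∩_; Nonempty; ∁)
open import Data.Fin.Subset.Properties using (∣∁p∣≡n∸∣p∣; ∣p∣≤n)
open import Data.List using (List; []; _∷_; map; _++_; upTo)
open import Data.List.Membership.Propositional using (_∈_)
open import Data.List.Membership.Propositional.Properties using (∈-upTo⁺)
open import Data.List.Properties using (map-++; map-∘)
import Data.List.Relation.Binary.Pointwise as Pointwise
open import Data.List.Relation.Binary.Pointwise using ([]; _∷_)
open import Data.List.Relation.Unary.Any using (here; there)
open import Data.Nat hiding (NonTrivial)
open import Data.Nat.Combinatorics
  using (_C_; nC1≡n; nCk+nC[k+1]≡[n+1]C[k+1]; nCk≡nC[n∸k]; k>n⇒nCk≡0)
open import Data.Nat.ListAction using (sum)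
open import Data.Nat.ListAction.Properties using (sum-++)
open import Data.Nat.Properties
open import Data.Product using (∃; _×_; _,_; proj₁)
open import Data.Sum using (_⊎_; inj₁; inj₂)
open import Data.Vec using ([]; _∷_; _∷ʳ_; here; there)
open import Function using (_∘_; const)
open import Relation.Binary.PropositionalEquality
open import Relation.Nullary using (¬_; Dec; yes; no; does; contradiction; _×-dec_)
open import Relation.Nullary.Decidable using (dec-true)

private variable
  n k ℓ r : ℕ

infix 4 _∋_ _⊑_

_∋_ : Family n → Subset n → Set
F ∋ A = F A ≡ true

does-true : {P : Set} (P? : Dec P) → does P? ≡ true → P
does-true (yes p) _ = p

-- Sums and cardinalities of families.

module _ {X : Set} where

  sum-mono : {f g : X → ℕ} → (∀ x → f x ≤ g x) → ∀ xs → sum (map f xs) ≤ sum (map g xs)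
  sum-mono f≤g []       = z≤n
  sum-mono f≤g (x ∷ xs) = +-mono-≤ (f≤g x) (sum-mono f≤g xs)

  sum-+ : (f g : X → ℕ) → ∀ xs →
          sum (map (λ x → f x + g x) xs) ≡ sum (map f xs) + sum (map g xs)
  sum-+ f g []       = refl
  sum-+ f g (x ∷ xs) = begin
    f x + g x + sum (map (λ y → f y + g y) xs)       ≡⟨ cong (f x + g x +_) (sum-+ f g xs) ⟩
    f x + g x + (sum (map f xs) + sum (map g xs))    ≡⟨ interchange +-commutativeSemigroup (f x) (g x) _ _ ⟩
    f x + sum (map f xs) + (g x + sum (map g xs))    ∎
    where
    open ≡-Reasoning

  term≤sum : (f : X → ℕ) → ∀ {x xs} → x ∈ xs → f x ≤ sum (map f xs)
  term≤sum f {xs = y ∷ ys} (here refl)  = m≤m+n (f y) _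
  term≤sum f {xs = y ∷ ys} (there x∈ys) = ≤-trans (term≤sum f x∈ys) (m≤n+m _ (f y))

indicator : Bool → ℕ
indicator b = if b then 1 else 0

card-mono : {F G : Family n} → (∀ A → F ∋ A → G ∋ A) → card F ≤ card G
card-mono {n} {F} {G} F⊆G = sum-mono pointwise (allSubsets n)
  where
  pointwise : ∀ A → indicator (F A) ≤ indicator (G A)
  pointwise A with F A in eq
  ... | false = z≤n
  ... | true rewrite F⊆G A eq = ≤-refl

card-⊎ : {F G T : Family n} → (∀ A → T ∋ A → F ∋ A ⊎ G ∋ A) → card T ≤ card F + card G
card-⊎ {n} {F} {G} {T} cover =
  ≤-trans (sum-mono pointwise (allSubsets n)) (≤-reflexive (sum-+ _ _ (allSubsets n)))
  where
  pointwise : ∀ A → indicator (T A) ≤ indicator (F A) + indicator (G A)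
  pointwise A with T A in eq
  ... | false = z≤n
  ... | true with cover A eq
  ...   | inj₁ f rewrite f = s≤s z≤n
  ...   | inj₂ g rewrite g = m≤n+m 1 _

card-disjoint : {F G T : Family n} → (∀ A → F ∋ A → T ∋ A) → (∀ A → G ∋ A → T ∋ A) →
                (∀ A → F ∋ A → ¬ G ∋ A) → card F + card G ≤ card T
card-disjoint {n} {F} {G} {T} F⊆T G⊆T F∩G≡∅ =
  ≤-trans (≤-reflexive (sym (sum-+ _ _ (allSubsets n)))) (sum-mono pointwise (allSubsets n))
  where
  pointwise : ∀ A → indicator (F A) + indicator (G A) ≤ indicator (T A)
  pointwise A with F A in eqF | G A in eqG
  ... | false | false = z≤n
  ... | false | true  rewrite G⊆T A eqG = ≤-refl
  ... | true  | false rewrite F⊆T A eqF = ≤-refl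
  ... | true  | true  = contradiction eqG (F∩G≡∅ A eqF)

card-empty : {F : Family n} → (∀ A → ¬ F ∋ A) → card F ≡ 0
card-empty {n} {F} F≡∅ =
  n≤0⇒n≡0 (≤-trans (card-mono {F = F} {G = const false} λ A → ⊥-elim ∘ F≡∅ A)
                    (≤-reflexive (zeros (allSubsets n))))
  where
  zeros : ∀ (xs : List (Subset n)) → sum (map (const 0) xs) ≡ 0
  zeros []       = refl
  zeros (_ ∷ xs) = zeros xs

-- Splitting by the first or the last element; complementation.

card-∷ : (F : Family (suc n)) → card F ≡ card (F ∘ (true ∷_)) + card (F ∘ (false ∷_))
card-∷ {n} F = begin
  sum (map f (map (true ∷_) S ++ map (false ∷_) S))
    ≡⟨ cong sum (map-++ f (map (true ∷_) S) _) ⟩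
  sum (map f (map (true ∷_) S) ++ map f (map (false ∷_) S))
    ≡⟨ sum-++ (map f (map (true ∷_) S)) _ ⟩
  sum (map f (map (true ∷_) S)) + sum (map f (map (false ∷_) S))
    ≡⟨ sym (cong₂ (λ u v → sum u + sum v) (map-∘ S) (map-∘ S)) ⟩
  card (F ∘ (true ∷_)) + card (F ∘ (false ∷_)) ∎
  where
  open ≡-Reasoning
  S = allSubsets n
  f = λ A → indicator (F A)

-- slice true F and slice false F are Frankl's F(n) and F(n̄).
slice : Bool → Family (suc n) → Family n
slice b F A = F (A ∷ʳ b)

-- `allSubsets` branches on the first element, so the last one is reached by recursion under both
-- branches, followed by regrouping the four parts.
card-slice : (F : Family (suc n)) → card F ≡ card (slice true F) + card (slice false F)
card-slice {zero}  F = card-∷ F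
card-slice {suc n} F = begin
  card F
    ≡⟨ card-∷ F ⟩
  card (F ∘ (true ∷_)) + card (F ∘ (false ∷_))
    ≡⟨ cong₂ _+_ (card-slice (F ∘ (true ∷_))) (card-slice (F ∘ (false ∷_))) ⟩
  card (slice true (F ∘ (true ∷_))) + card (slice false (F ∘ (true ∷_))) +
  (card (slice true (F ∘ (false ∷_))) + card (slice false (F ∘ (false ∷_))))
    ≡⟨ interchange +-commutativeSemigroup (card (slice true (F ∘ (true ∷_)))) _ _ _ ⟩
  card (slice true (F ∘ (true ∷_))) + card (slice true (F ∘ (false ∷_))) +
  (card (slice false (F ∘ (true ∷_))) + card (slice false (F ∘ (false ∷_))))
    ≡⟨ sym (cong₂ _+_ (card-∷ (slice true F)) (card-∷ (slice false F))) ⟩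
  card (slice true F) + card (slice false F) ∎
  where
  open ≡-Reasoning

-- Lets `G` be counted through the complements of its members. Complementing exchanges the two
-- halves given by the first element.
card-∁ : (F : Family n) → card (F ∘ ∁) ≡ card F
card-∁ {zero}  F = refl
card-∁ {suc n} F = begin
  card (F ∘ ∁)
    ≡⟨ card-∷ (F ∘ ∁) ⟩
  card (F ∘ (false ∷_) ∘ ∁) + card (F ∘ (true ∷_) ∘ ∁)
    ≡⟨ cong₂ _+_ (card-∁ (F ∘ (false ∷_))) (card-∁ (F ∘ (true ∷_))) ⟩
  card (F ∘ (false ∷_)) + card (F ∘ (true ∷_))
    ≡⟨ +-comm (card (F ∘ (false ∷_))) _ ⟩
  card (F ∘ (true ∷_)) + card (F ∘ (false ∷_))
    ≡⟨ sym (card-∷ F) ⟩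
  card F ∎
  where open ≡-Reasoning

-- Sizes and prefix counts.

∣∷ʳ∣-true : (A : Subset n) → ∣ A ∷ʳ true ∣ ≡ suc ∣ A ∣
∣∷ʳ∣-true []          = refl
∣∷ʳ∣-true (true ∷ A)  = cong suc (∣∷ʳ∣-true A)
∣∷ʳ∣-true (false ∷ A) = ∣∷ʳ∣-true A

∣∷ʳ∣-false : (A : Subset n) → ∣ A ∷ʳ false ∣ ≡ ∣ A ∣
∣∷ʳ∣-false []          = refl
∣∷ʳ∣-false (true ∷ A)  = cong suc (∣∷ʳ∣-false A)
∣∷ʳ∣-false (false ∷ A) = ∣∷ʳ∣-false A

-- prefix s A = |A ∩ [s]|, also when s exceeds the size of the ground set.
prefix : ℕ → Subset n → ℕ
prefix zero    _           = 0
prefix (suc s) []          = 0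
prefix (suc s) (true ∷ A)  = suc (prefix s A)
prefix (suc s) (false ∷ A) = prefix s A

prefix-∷ʳ : ∀ s (A : Subset n) b → s ≤ n → prefix s (A ∷ʳ b) ≡ prefix s A
prefix-∷ʳ zero    A           b _         = refl
prefix-∷ʳ (suc s) (true ∷ A)  b (s≤s s≤n) = cong suc (prefix-∷ʳ s A b s≤n)
prefix-∷ʳ (suc s) (false ∷ A) b (s≤s s≤n) = prefix-∷ʳ s A b s≤n

prefix≤∣∣ : ∀ s (A : Subset n) → prefix s A ≤ ∣ A ∣
prefix≤∣∣ zero    A           = z≤n
prefix≤∣∣ (suc s) []          = z≤n
prefix≤∣∣ (suc s) (true ∷ A)  = s≤s (prefix≤∣∣ s A)
prefix≤∣∣ (suc s) (false ∷ A) = prefix≤∣∣ s A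

∣∣≤prefix+ : ∀ s (A : Subset n) → ∣ A ∣ ≤ prefix s A + (n ∸ s)
∣∣≤prefix+ zero    A           = ∣p∣≤n A
∣∣≤prefix+ (suc s) []          = z≤n
∣∣≤prefix+ (suc s) (true ∷ A)  = s≤s (∣∣≤prefix+ s A)
∣∣≤prefix+ (suc s) (false ∷ A) = ∣∣≤prefix+ s A

prefix-∁ : ∀ s (A : Subset n) → s ≤ n → prefix s A + prefix s (∁ A) ≡ s
prefix-∁ zero    A           _         = refl
prefix-∁ (suc s) (true ∷ A)  (s≤s s≤n) = cong suc (prefix-∁ s A s≤n)
prefix-∁ (suc s) (false ∷ A) (s≤s s≤n) = trans (+-suc _ _) (cong suc (prefix-∁ s A s≤n))

-- Families fixed by size and prefix count.

opaque

  level : ∀ n → ℕ → Family n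
  level n k A = does (∣ A ∣ ≟ k)

  level-∋ : (A : Subset n) → ∣ A ∣ ≡ k → level n k ∋ A
  level-∋ {k = k} A = dec-true (∣ A ∣ ≟ k)

  ∋-level : (A : Subset n) → level n k ∋ A → ∣ A ∣ ≡ k
  ∋-level {k = k} A = does-true (∣ A ∣ ≟ k)

  heavy light : ∀ n → ℕ → ℕ → Family n
  heavy n k s A = does ((∣ A ∣ ≟ k) ×-dec (2 ≤? prefix s A))
  light n k s A = does ((∣ A ∣ ≟ k) ×-dec (prefix s A <? 2))

  heavy-∋ : (A : Subset n) → ∣ A ∣ ≡ k → 2 ≤ prefix r A → heavy n k r ∋ A
  heavy-∋ {k = k} {r} A p q = dec-true ((∣ A ∣ ≟ k) ×-dec (2 ≤? prefix r A)) (p , q)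

  ∋-heavy : (A : Subset n) → heavy n k r ∋ A → ∣ A ∣ ≡ k × 2 ≤ prefix r A
  ∋-heavy {k = k} {r} A = does-true ((∣ A ∣ ≟ k) ×-dec (2 ≤? prefix r A))

  light-∋ : (A : Subset n) → ∣ A ∣ ≡ k → prefix r A < 2 → light n k r ∋ A
  light-∋ {k = k} {r} A p q = dec-true ((∣ A ∣ ≟ k) ×-dec (prefix r A <? 2)) (p , q)

  ∋-light : (A : Subset n) → light n k r ∋ A → ∣ A ∣ ≡ k × prefix r A < 2
  ∋-light {k = k} {r} A = does-true ((∣ A ∣ ≟ k) ×-dec (prefix r A <? 2))

-- Shifting and disjointness.

-- The shifting order, generated by exchanging neighbours; unlike _≺_ it is
-- evidently compatible with appending an element at the end.
data _⊑_ : Subset n → Subset n → Set where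
  ⊑-refl  : {A : Subset n} → A ⊑ A
  ⊑-trans : {A B C : Subset n} → A ⊑ B → B ⊑ C → A ⊑ C
  ⊑-∷     : ∀ b {A B : Subset n} → A ⊑ B → b ∷ A ⊑ b ∷ B
  ⊑-swap  : (A : Subset n) → true ∷ false ∷ A ⊑ false ∷ true ∷ A

⊑-∷ʳ : ∀ {A B : Subset n} b → A ⊑ B → A ∷ʳ b ⊑ B ∷ʳ b
⊑-∷ʳ b ⊑-refl        = ⊑-refl
⊑-∷ʳ b (⊑-trans p q) = ⊑-trans (⊑-∷ʳ b p) (⊑-∷ʳ b q)
⊑-∷ʳ b (⊑-∷ c p)     = ⊑-∷ c (⊑-∷ʳ b p)
⊑-∷ʳ b (⊑-swap A)    = ⊑-swap (A ∷ʳ b)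

⊑-∣∣ : {A B : Subset n} → A ⊑ B → ∣ A ∣ ≡ ∣ B ∣
⊑-∣∣ ⊑-refl          = refl
⊑-∣∣ (⊑-trans p q)   = trans (⊑-∣∣ p) (⊑-∣∣ q)
⊑-∣∣ (⊑-∷ true p)    = cong suc (⊑-∣∣ p)
⊑-∣∣ (⊑-∷ false p)   = ⊑-∣∣ p
⊑-∣∣ (⊑-swap A)      = refl

⊑⇒≺ : {A B : Subset n} → A ⊑ B → A ≺ B
⊑⇒≺ ⊑-refl        = Pointwise.refl Fin.≤-refl
⊑⇒≺ (⊑-trans p q) = Pointwise.transitive Fin.≤-trans (⊑⇒≺ p) (⊑⇒≺ q)
⊑⇒≺ (⊑-∷ true p)  = z≤n ∷ Pointwise.map⁺ fsuc fsuc (Pointwise.map s≤s (⊑⇒≺ p))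
⊑⇒≺ (⊑-∷ false p) = Pointwise.map⁺ fsuc fsuc (Pointwise.map s≤s (⊑⇒≺ p))
⊑⇒≺ (⊑-swap A)    = z≤n ∷ Pointwise.refl Fin.≤-refl

-- The last element travels forward by neighbour swaps: it passes over an absent point, while a
-- present point takes over the rest of the journey.
last-to-front : (A : Subset n) → true ∷ (A ∷ʳ false) ⊑ false ∷ (A ∷ʳ true)
last-to-front []          = ⊑-swap []
last-to-front (true ∷ A)  = ⊑-trans (⊑-∷ true (last-to-front A)) (⊑-swap (A ∷ʳ true))
last-to-front (false ∷ A) = ⊑-trans (⊑-swap (A ∷ʳ false)) (⊑-∷ false (last-to-front A))

-- An inductive form of empty intersection, so that proofs recurse on both sets at once.
data Disjoint : Subset n → Subset n → Set where
  []      : Disjoint [] []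
  left    : {A B : Subset n} → Disjoint A B → Disjoint (true ∷ A) (false ∷ B)
  right   : {A B : Subset n} → Disjoint A B → Disjoint (false ∷ A) (true ∷ B)
  neither : {A B : Subset n} → Disjoint A B → Disjoint (false ∷ A) (false ∷ B)

Disjoint-sym : {A B : Subset n} → Disjoint A B → Disjoint B A
Disjoint-sym []          = []
Disjoint-sym (left d)    = right (Disjoint-sym d)
Disjoint-sym (right d)   = left (Disjoint-sym d)
Disjoint-sym (neither d) = neither (Disjoint-sym d)

Disjoint⇒Empty : {A B : Subset n} → Disjoint A B → ¬ Nonempty (A ∩ B)
Disjoint⇒Empty (left d)    (fsuc x , there p) = Disjoint⇒Empty d (x , p)
Disjoint⇒Empty (right d)   (fsuc x , there p) = Disjoint⇒Empty d (x , p)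
Disjoint⇒Empty (neither d) (fsuc x , there p) = Disjoint⇒Empty d (x , p)

Disjoint-∁ : (A : Subset n) → Disjoint A (∁ A)
Disjoint-∁ []          = []
Disjoint-∁ (true ∷ A)  = left (Disjoint-∁ A)
Disjoint-∁ (false ∷ A) = right (Disjoint-∁ A)

Disjoint-∷ʳ : ∀ {A B : Subset n} b → Disjoint A B → Disjoint (A ∷ʳ false) (B ∷ʳ b)
Disjoint-∷ʳ true  []          = right []
Disjoint-∷ʳ false []          = neither []
Disjoint-∷ʳ b     (left d)    = left (Disjoint-∷ʳ b d)
Disjoint-∷ʳ b     (right d)   = right (Disjoint-∷ʳ b d)
Disjoint-∷ʳ b     (neither d) = neither (Disjoint-∷ʳ b d)

-- By the size bound some point lies in neither set; the appended element is moved to the first such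
-- point.
replace-last : {A B : Subset n} → Disjoint A B → ∣ A ∣ + ∣ B ∣ < n →
               ∃ λ A′ → A′ ∷ʳ false ⊑ A ∷ʳ true × Disjoint A′ B
replace-last (left d) (s≤s lt) with replace-last d lt
... | A′ , p , d′ = true ∷ A′ , ⊑-∷ true p , left d′
replace-last {A = false ∷ A} {B = true ∷ B} (right d) lt
  with replace-last d (≤-trans (≤-reflexive (sym (+-suc ∣ A ∣ ∣ B ∣))) (s≤s⁻¹ lt))
... | A′ , p , d′ = false ∷ A′ , ⊑-∷ false p , right d′
replace-last {A = false ∷ A} (neither d) _ = true ∷ A , last-to-front A , left d

-- Pairs of families and their slices.

DownClosed : Family n → Set
DownClosed F = ∀ {A B} → A ⊑ B → F ∋ B → F ∋ A

-- The properties that pass to both slices. The first family is the one whose members get shifted by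
-- `replace-last`.
record Configuration (n k ℓ : ℕ) (F G : Family n) : Set where
  field
    uniformˡ   : Uniform k F
    uniformʳ   : Uniform ℓ G
    downClosed : DownClosed F
    cross      : ∀ {A B} → F ∋ A → G ∋ B → ¬ Disjoint A B

open Configuration

without-last : ∀ {F G : Family (suc n)} → Configuration (suc n) k ℓ F G →
               Configuration n k ℓ (slice false F) (slice false G)
without-last c .uniformˡ A f   = trans (sym (∣∷ʳ∣-false A)) (c .uniformˡ (A ∷ʳ false) f)
without-last c .uniformʳ A g   = trans (sym (∣∷ʳ∣-false A)) (c .uniformʳ (A ∷ʳ false) g)
without-last c .downClosed p f = c .downClosed (⊑-∷ʳ false p) f
without-last c .cross f g d    = c .cross f g (Disjoint-∷ʳ false d)

-- If `A` and `B` in the links were disjoint, the last element of the first set could move to a free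
-- point. The result avoids the last point, lies in `F`, and is disjoint from `B` with the last
-- point added.
through-last : ∀ {F G : Family (suc n)} → k + ℓ < n → Configuration (suc n) (suc k) (suc ℓ) F G →
               Configuration n k ℓ (slice true F) (slice true G)
through-last lt c .uniformˡ A f =
  suc-injective (trans (sym (∣∷ʳ∣-true A)) (c .uniformˡ (A ∷ʳ true) f))
through-last lt c .uniformʳ A g =
  suc-injective (trans (sym (∣∷ʳ∣-true A)) (c .uniformʳ (A ∷ʳ true) g))
through-last lt c .downClosed p f = c .downClosed (⊑-∷ʳ true p) f
through-last lt c .cross {A} {B} f g d =
  let sizes = cong₂ _+_ (through-last lt c .uniformˡ A f) (through-last lt c .uniformʳ B g)
      _ , A′⊑A , d′ = replace-last d (≤-trans (≤-reflexive (cong suc sizes)) lt)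
  in c .cross (c .downClosed A′⊑A f) g (Disjoint-∷ʳ true d′)

card-slice₂ : (F G : Family (suc n)) →
              card F + card G ≡
              card (slice true F) + card (slice true G) + (card (slice false F) + card (slice false G))
card-slice₂ F G = trans (cong₂ _+_ (card-slice F) (card-slice G))
  (interchange +-commutativeSemigroup (card (slice true F)) _ _ _)

-- The inductive step shared by `level-bound` and `heavy-bound`: the bounding family is sliced along
-- with `F` and `G`.
card-slice-≤ : ∀ {F G T : Family (suc n)} →
               card (slice true F) + card (slice true G) ≤ card (slice true T) →
               card (slice false F) + card (slice false G) ≤ card (slice false T) →
               card F + card G ≤ card T
card-slice-≤ {F = F} {G} {T} p q = begin
  card F + card G
    ≡⟨ card-slice₂ F G ⟩
  card (slice true F) + card (slice true G) + (card (slice false F) + card (slice false G))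
    ≤⟨ +-mono-≤ p q ⟩
  card (slice true T) + card (slice false T)
    ≡⟨ sym (card-slice T) ⟩
  card T ∎
  where open ≤-Reasoning

complement-size : (A : Subset n) → n ≡ k + ℓ → ∣ ∁ A ∣ ≡ ℓ → ∣ A ∣ ≡ k
complement-size {n} {k} {ℓ} A n≡k+ℓ ∣∁A∣≡ℓ = +-cancelʳ-≡ ℓ ∣ A ∣ k (begin
  ∣ A ∣ + ℓ            ≡⟨ cong (∣ A ∣ +_) (trans (sym ∣∁A∣≡ℓ) (∣∁p∣≡n∸∣p∣ A)) ⟩
  ∣ A ∣ + (n ∸ ∣ A ∣)  ≡⟨ m+[n∸m]≡n (∣p∣≤n A) ⟩
  n                    ≡⟨ n≡k+ℓ ⟩
  k + ℓ                ∎)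
  where open ≡-Reasoning

-- `F` and the complements of members of `G` are disjoint inside `T`: a common set would be a member
-- of `F` disjoint from its own complement in `G`.
complement-bound : {F G T : Family n} → Configuration n k ℓ F G →
                   (∀ A → F ∋ A → T ∋ A) → (∀ A → G ∋ ∁ A → T ∋ A) → card F + card G ≤ card T
complement-bound {F = F} {G} c F⊆T ∁G⊆T = ≤-trans
  (≤-reflexive (cong (card F +_) (sym (card-∁ G))))
  (card-disjoint {F = F} {G ∘ ∁} F⊆T ∁G⊆T (λ A f g → c .cross f g (Disjoint-∁ A)))

empty-bound : {F G T : Family n} →
              (∀ A → ¬ G ∋ A) → (∀ A → F ∋ A → T ∋ A) → card F + card G ≤ card T
empty-bound {F = F} {G} G≡∅ F⊆T =
  card-disjoint {F = F} {G} F⊆T (λ A → ⊥-elim ∘ G≡∅ A) (λ A _ → G≡∅ A)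

level⊆slice-true : ∀ A → level n k ∋ A → slice true (level (suc n) (suc k)) ∋ A
level⊆slice-true A p = level-∋ (A ∷ʳ true) (trans (∣∷ʳ∣-true A) (cong suc (∋-level A p)))

level⊆slice-false : ∀ A → level n k ∋ A → slice false (level (suc n) k) ∋ A
level⊆slice-false A p = level-∋ (A ∷ʳ false) (trans (∣∷ʳ∣-false A) (∋-level A p))

-- At `n = k + ℓ` the complements of members of `G` are `k`-sets outside `F`. For larger `n` both
-- slices are again configurations, with both sizes one lower in the link.
level-bound : ∀ n k ℓ {F G : Family n} → ℓ ≤ k → k + ℓ ≤ n → Configuration n k ℓ F G →
              card F + card G ≤ card (level n k)
level-bound n k ℓ {F} {G} ℓ≤k k+ℓ≤n c with m≤n⇒m<n∨m≡n k+ℓ≤n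
... | inj₂ k+ℓ≡n = complement-bound {F = F} c (λ A f → level-∋ A (c .uniformˡ A f))
        (λ A g → level-∋ A (complement-size A (sym k+ℓ≡n) (c .uniformʳ (∁ A) g)))
-- A member of `G` has size 0 here, so the link of `G` is empty and no induction on `k` takes place.
level-bound (suc n) k zero {F} {G} ℓ≤k k+ℓ≤n c | inj₁ k+ℓ<n =
  card-slice-≤ {F = F} {G} {T = level (suc n) k}
    (empty-bound {F = slice true F}
      (λ A g → contradiction (trans (sym (∣∷ʳ∣-true A)) (c .uniformʳ (A ∷ʳ true) g)) λ ())
      (λ A f → level-∋ (A ∷ʳ true) (c .uniformˡ (A ∷ʳ true) f)))
    (≤-trans (level-bound n k 0 ℓ≤k (s≤s⁻¹ k+ℓ<n) (without-last c))
             (card-mono {n} level⊆slice-false))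
level-bound (suc n) (suc k) (suc ℓ) {F} {G} (s≤s ℓ≤k) k+ℓ≤n c | inj₁ k+ℓ<n =
  card-slice-≤ {F = F} {G} {T = level (suc n) (suc k)}
    (≤-trans (level-bound n k ℓ ℓ≤k (<⇒≤ k+ℓ<n′) (through-last k+ℓ<n′ c))
             (card-mono {n} level⊆slice-true))
    (≤-trans (level-bound n (suc k) (suc ℓ) (s≤s ℓ≤k) (s≤s⁻¹ k+ℓ<n) (without-last c))
             (card-mono {n} level⊆slice-false))
  where
  k+ℓ<n′ : k + ℓ < n
  k+ℓ<n′ = ≤-trans (s≤s (+-monoʳ-≤ k (n≤1+n ℓ))) (s≤s⁻¹ k+ℓ<n)

-- Families whose members meet a prefix twice.

MeetsPrefix : ℕ → Family n → Set
MeetsPrefix s F = ∀ A → F ∋ A → 2 ≤ prefix s A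

MeetsPrefix-slice : ∀ b {F : Family (suc n)} → r ≤ n → MeetsPrefix r F → MeetsPrefix r (slice b F)
MeetsPrefix-slice b r≤n m A f = subst (2 ≤_) (prefix-∷ʳ _ A b r≤n) (m (A ∷ʳ b) f)

heavy⊆slice-true : r ≤ n → ∀ A → heavy n k r ∋ A → slice true (heavy (suc n) (suc k) r) ∋ A
heavy⊆slice-true r≤n A h with ∋-heavy A h
... | p , q = heavy-∋ (A ∷ʳ true) (trans (∣∷ʳ∣-true A) (cong suc p))
                      (subst (2 ≤_) (sym (prefix-∷ʳ _ A true r≤n)) q)

heavy⊆slice-false : r ≤ n → ∀ A → heavy n k r ∋ A → slice false (heavy (suc n) k r) ∋ A
heavy⊆slice-false r≤n A h with ∋-heavy A h
... | p , q = heavy-∋ (A ∷ʳ false) (trans (∣∷ʳ∣-false A) p)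
                      (subst (2 ≤_) (sym (prefix-∷ʳ _ A false r≤n)) q)

-- At most `n ∸ r` elements lie beyond the prefix, which leaves at least `ℓ` inside. If `n ≤ r` the
-- truncated difference is 0, and `ℓ ≤ k` gives the same.
level⊆heavy : 2 ≤ ℓ → n + ℓ ≤ r + k → ℓ ≤ k → ∀ A → level n k ∋ A → heavy n k r ∋ A
level⊆heavy {ℓ} {n} {r} {k} 2≤ℓ n+ℓ≤r+k ℓ≤k A p = heavy-∋ A ∣A∣≡k (≤-trans 2≤ℓ ℓ≤prefix)
  where
  ∣A∣≡k = ∋-level A p
  ℓ+[n∸r]≤k : ℓ + (n ∸ r) ≤ k
  ℓ+[n∸r]≤k with ≤-total r n
  ... | inj₂ n≤r rewrite m≤n⇒m∸n≡0 n≤r | +-identityʳ ℓ = ℓ≤k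
  ... | inj₁ r≤n = +-cancelˡ-≤ r _ _ (begin
    r + (ℓ + (n ∸ r))  ≡⟨ cong (r +_) (+-comm ℓ _) ⟩
    r + (n ∸ r + ℓ)    ≡⟨ sym (+-assoc r _ ℓ) ⟩
    r + (n ∸ r) + ℓ    ≡⟨ cong (_+ ℓ) (m+[n∸m]≡n r≤n) ⟩
    n + ℓ              ≤⟨ n+ℓ≤r+k ⟩
    r + k              ∎)
    where open ≤-Reasoning
  ℓ≤prefix : ℓ ≤ prefix r A
  ℓ≤prefix = +-cancelʳ-≤ (n ∸ r) _ _ (begin
    ℓ + (n ∸ r)           ≤⟨ ℓ+[n∸r]≤k ⟩
    k                     ≡⟨ sym ∣A∣≡k ⟩
    ∣ A ∣                 ≤⟨ ∣∣≤prefix+ r A ⟩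
    prefix r A + (n ∸ r)  ∎)
    where open ≤-Reasoning

-- G is empty if ℓ < 2. If ℓ ≥ 2 and n ≤ s or n ≤ t, then the inequalities between the parameters
-- force every k-set to meet [s] twice, so that level-bound suffices.
heavy-bound : ∀ n k ℓ s t {F G : Family n} → ℓ ≤ k → k + ℓ ≤ n → 2 + ℓ ≤ s → t + ℓ ≤ s + k →
              MeetsPrefix s F → MeetsPrefix t G → Configuration n k ℓ F G →
              card F + card G ≤ card (heavy n k s)
heavy-bound n k ℓ s t {F} {G} ℓ≤k k+ℓ≤n 2+ℓ≤s t+ℓ≤s+k mF mG c with 2 ≤? ℓ
... | no 2≰ℓ = empty-bound {F = F}
  (λ A g → 2≰ℓ (≤-trans (mG A g) (≤-trans (prefix≤∣∣ t A) (≤-reflexive (c .uniformʳ A g)))))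
  (λ A f → heavy-∋ A (c .uniformˡ A f) (mF A f))
... | yes 2≤ℓ with n ≤? s
...   | yes n≤s = ≤-trans (level-bound n k ℓ ℓ≤k k+ℓ≤n c)
          (card-mono (level⊆heavy 2≤ℓ (+-mono-≤ n≤s ℓ≤k) ℓ≤k))
...   | no n≰s with n ≤? t
...     | yes n≤t = ≤-trans (level-bound n k ℓ ℓ≤k k+ℓ≤n c)
            (card-mono (level⊆heavy 2≤ℓ (≤-trans (+-monoˡ-≤ ℓ n≤t) t+ℓ≤s+k) ℓ≤k))
...     | no n≰t with m≤n⇒m<n∨m≡n k+ℓ≤n
...       | inj₂ k+ℓ≡n = complement-bound {F = F} c
              (λ A f → heavy-∋ A (c .uniformˡ A f) (mF A f))
              (λ A g → heavy-∋ A (complement-size A (sym k+ℓ≡n) (c .uniformʳ (∁ A) g))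
                                 (leaves-two A (c .uniformʳ (∁ A) g)))
  where
  leaves-two : ∀ A → ∣ ∁ A ∣ ≡ ℓ → 2 ≤ prefix s A
  leaves-two A ∣∁A∣≡ℓ = +-cancelʳ-≤ ℓ _ _ (begin
    2 + ℓ                        ≤⟨ 2+ℓ≤s ⟩
    s                            ≡⟨ sym (prefix-∁ s A (<⇒≤ (≰⇒> n≰s))) ⟩
    prefix s A + prefix s (∁ A)  ≤⟨ +-monoʳ-≤ (prefix s A) (prefix≤∣∣ s (∁ A)) ⟩
    prefix s A + ∣ ∁ A ∣         ≡⟨ cong (prefix s A +_) ∣∁A∣≡ℓ ⟩
    prefix s A + ℓ               ∎)
    where open ≤-Reasoning
heavy-bound (suc n) (suc k) (suc ℓ) s t {F} {G} (s≤s ℓ≤k) k+ℓ≤n 2+ℓ≤s t+ℓ≤s+k mF mG c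
  | yes 2≤ℓ | no n≰s | no n≰t | inj₁ k+ℓ<n =
  card-slice-≤ {F = F} {G} {T = heavy (suc n) (suc k) s}
    (≤-trans
      -- The link lowers `k` and `ℓ` but keeps the prefixes. Hence `s` and `t` are separate
      -- parameters, tied to the sizes only by inequalities that survive: the first gains slack, the
      -- second loses one on each side.
      (heavy-bound n k ℓ s t ℓ≤k (<⇒≤ k+ℓ<n′) (<⇒≤ 2+ℓ≤s) t+ℓ≤s+k′
        (MeetsPrefix-slice true s≤n mF) (MeetsPrefix-slice true t≤n mG) (through-last k+ℓ<n′ c))
      (card-mono (heavy⊆slice-true s≤n)))
    (≤-trans
      (heavy-bound n (suc k) (suc ℓ) s t (s≤s ℓ≤k) (s≤s⁻¹ k+ℓ<n) 2+ℓ≤s t+ℓ≤s+k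
        (MeetsPrefix-slice false s≤n mF) (MeetsPrefix-slice false t≤n mG) (without-last c))
      (card-mono (heavy⊆slice-false s≤n)))
  where
  s≤n : s ≤ n
  s≤n = s≤s⁻¹ (≰⇒> n≰s)
  t≤n : t ≤ n
  t≤n = s≤s⁻¹ (≰⇒> n≰t)
  k+ℓ<n′ : k + ℓ < n
  k+ℓ<n′ = ≤-trans (s≤s (+-monoʳ-≤ k (n≤1+n ℓ))) (s≤s⁻¹ k+ℓ<n)
  t+ℓ≤s+k′ : t + ℓ ≤ s + k
  t+ℓ≤s+k′ = s≤s⁻¹ (subst₂ _≤_ (+-suc t ℓ) (+-suc s k) t+ℓ≤s+k)

-- Counting level and light families.

card-level : ∀ n k → card (level n k) ≤ n C k
-- `level` is opaque here, so both truth values are treated; each contributes at most 1.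
card-level zero zero with level 0 0 []
... | true  = ≤-refl
... | false = z≤n
card-level zero (suc k) = ≤-reflexive (card-empty {F = level 0 (suc k)} λ { [] p → 0≢1+n (∋-level [] p) })
card-level (suc n) zero = begin
  card (level (suc n) 0)
    ≡⟨ card-∷ (level (suc n) 0) ⟩
  card (level (suc n) 0 ∘ (true ∷_)) + card (level (suc n) 0 ∘ (false ∷_))
    ≤⟨ +-mono-≤ (≤-reflexive (card-empty {n} λ A p → 1+n≢0 (∋-level (true ∷ A) p)))
                (card-mono {n} λ A p → level-∋ A (∋-level (false ∷ A) p)) ⟩
  card (level n 0)
    ≤⟨ card-level n 0 ⟩
  1 ∎
  where open ≤-Reasoning
card-level (suc n) (suc k) = begin
  card (level (suc n) (suc k))
    ≡⟨ card-∷ (level (suc n) (suc k)) ⟩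
  card (level (suc n) (suc k) ∘ (true ∷_)) + card (level (suc n) (suc k) ∘ (false ∷_))
    ≤⟨ +-mono-≤ (card-mono {n} λ A p → level-∋ A (suc-injective (∋-level (true ∷ A) p)))
                (card-mono {n} λ A p → level-∋ A (∋-level (false ∷ A) p)) ⟩
  card (level n k) + card (level n (suc k))
    ≤⟨ +-mono-≤ (card-level n k) (card-level n (suc k)) ⟩
  n C k + n C (suc k)
    ≡⟨ nCk+nC[k+1]≡[n+1]C[k+1] n k ⟩
  suc n C suc k ∎
  where open ≤-Reasoning

-- A light (a+1)-set consists of all a elements beyond s and one element of [s].
card-light : ∀ a s → card (light (a + s) (suc a) s) ≤ s
card-light zero s = begin
  card (light s 1 s)  ≤⟨ card-mono {s} (λ A p → level-∋ A (proj₁ (∋-light A p))) ⟩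
  card (level s 1)    ≤⟨ card-level s 1 ⟩
  s C 1               ≡⟨ nC1≡n s ⟩
  s                   ∎
  where open ≤-Reasoning
card-light (suc a) s = begin
  card L
    ≡⟨ card-slice L ⟩
  card (slice true L) + card (slice false L)
    ≤⟨ +-mono-≤ (card-mono drop-last) (≤-reflexive (card-empty last-needed)) ⟩
  card (light (a + s) (suc a) s) + 0
    ≡⟨ +-identityʳ _ ⟩
  card (light (a + s) (suc a) s)
    ≤⟨ card-light a s ⟩
  s ∎
  where
  open ≤-Reasoning
  L = light (suc a + s) (suc (suc a)) s
  s≤a+s = m≤n+m s a
  drop-last : ∀ A → slice true L ∋ A → light (a + s) (suc a) s ∋ A
  drop-last A p with ∋-light (A ∷ʳ true) p
  ... | size , few = light-∋ A (suc-injective (trans (sym (∣∷ʳ∣-true A)) size))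
                               (subst (_< 2) (prefix-∷ʳ s A true s≤a+s) few)
  -- Without the last point there would be at most one element in the prefix and `a` beyond it,
  -- short of `a + 2`.
  last-needed : ∀ A → ¬ slice false L ∋ A
  last-needed A p with ∋-light (A ∷ʳ false) p
  ... | size , few = <-irrefl refl (begin-strict
    suc a                       <⟨ ≤-refl ⟩
    suc (suc a)                 ≡⟨ sym (trans (sym (∣∷ʳ∣-false A)) size) ⟩
    ∣ A ∣                       ≤⟨ ∣∣≤prefix+ s A ⟩
    prefix s A + (a + s ∸ s)    ≡⟨ cong (prefix s A +_) (m+n∸n≡m a s) ⟩
    prefix s A + a              ≤⟨ +-monoˡ-≤ a (s≤s⁻¹ (subst (_< 2) (prefix-∷ʳ s A false s≤a+s) few)) ⟩
    suc a                       ∎)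

-- The induction on the excess of n over k + ℓ.

-- Here `k = a + 1`, `ℓ = b + 1`, and `m` is the excess `n - k - ℓ`. The extra `ℓ + 1` arises once,
-- from the light sets at excess 0; each later step adds a link, which `heavy-bound` controls with
-- no extra term.
meets-prefix-bound : ∀ m a b {F G : Family (m + (a + suc (suc b)))} → b ≤ a →
  MeetsPrefix (suc (suc b)) F → MeetsPrefix (suc (suc a)) G →
  Configuration (m + (a + suc (suc b))) (suc a) (suc b) F G →
  card F + card G ≤ card (heavy (m + (a + suc (suc b))) (suc a) (suc (suc b))) + suc (suc b)
meets-prefix-bound zero a b {F} {G} b≤a mF mG c = begin
  card F + card G
    ≤⟨ level-bound (a + s) (suc a) (suc b) (s≤s b≤a) (≤-reflexive (sym (+-suc a (suc b)))) c ⟩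
  card (level (a + s) (suc a))
    ≤⟨ card-⊎ split ⟩
  card (heavy (a + s) (suc a) s) + card (light (a + s) (suc a) s)
    ≤⟨ +-monoʳ-≤ (card (heavy (a + s) (suc a) s)) (card-light a s) ⟩
  card (heavy (a + s) (suc a) s) + s ∎
  where
  open ≤-Reasoning
  s = suc (suc b)
  split : ∀ A → level (a + s) (suc a) ∋ A → heavy (a + s) (suc a) s ∋ A ⊎ light (a + s) (suc a) s ∋ A
  split A p with 2 ≤? prefix s A
  ... | yes many = inj₁ (heavy-∋ A (∋-level A p) many)
  ... | no few   = inj₂ (light-∋ A (∋-level A p) (≰⇒> few))
meets-prefix-bound (suc m) a b {F} {G} b≤a mF mG c = begin
  card F + card G
    ≡⟨ card-slice₂ F G ⟩
  card (slice true F) + card (slice true G) + (card (slice false F) + card (slice false G))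
    ≤⟨ +-mono-≤
         -- Both prefix inequalities start as equalities: `s = b + 2` and `t + b = s + a`.
         (heavy-bound N a b s t b≤a (<⇒≤ a+b<n) ≤-refl (≤-reflexive (cong (suc ∘ suc) (+-comm a b)))
           (MeetsPrefix-slice true s≤n mF) (MeetsPrefix-slice true t≤n mG) (through-last a+b<n c))
         (meets-prefix-bound m a b b≤a
           (MeetsPrefix-slice false s≤n mF) (MeetsPrefix-slice false t≤n mG) (without-last c)) ⟩
  card (heavy N a s) + (card (heavy N (suc a) s) + s)
    ≡⟨ sym (+-assoc (card (heavy N a s)) _ s) ⟩
  card (heavy N a s) + card (heavy N (suc a) s) + s
    ≤⟨ +-monoˡ-≤ s (+-mono-≤ (card-mono (heavy⊆slice-true s≤n)) (card-mono (heavy⊆slice-false s≤n))) ⟩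
  card (slice true H) + card (slice false H) + s
    ≡⟨ cong (_+ s) (sym (card-slice H)) ⟩
  card H + s ∎
  where
  open ≤-Reasoning
  s = suc (suc b)
  t = suc (suc a)
  N = m + (a + s)
  H = heavy (suc N) (suc a) s
  s≤n : s ≤ N
  s≤n = ≤-trans (m≤n+m s a) (m≤n+m (a + s) m)
  a+b+2≤n : suc (suc (a + b)) ≤ N
  a+b+2≤n = ≤-trans (≤-reflexive (sym (trans (+-suc a (suc b)) (cong suc (+-suc a b))))) (m≤n+m (a + s) m)
  a+b<n : a + b < N
  a+b<n = <⇒≤ a+b+2≤n
  t≤n : t ≤ N
  t≤n = ≤-trans (s≤s (s≤s (m≤m+n a b))) a+b+2≤n

-- Counting heavy sets by the binomial sum.

binomSub-suc : ∀ m k i → binomSub m (suc k) (suc i) ≡ binomSub m k i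
binomSub-suc m k zero    = refl
binomSub-suc m k (suc i) = refl

binomSub-diagonal : ∀ m k → binomSub m k k ≡ 1
binomSub-diagonal m zero    = refl
binomSub-diagonal m (suc k) = trans (binomSub-suc m k k) (binomSub-diagonal m k)

-- Pascal's rule survives the zero convention: at `i = k + 1` it reads 0 + 1 = 1, and beyond that
-- all terms vanish.
binomSub-pascal : ∀ m k i → binomSub m k i + binomSub m (suc k) i ≡ binomSub (suc m) (suc k) i
binomSub-pascal m k       zero          = nCk+nC[k+1]≡[n+1]C[k+1] m k
binomSub-pascal m zero    (suc zero)    = refl
binomSub-pascal m zero    (suc (suc i)) = refl
binomSub-pascal m (suc k) (suc i)       = begin
  binomSub m (suc k) (suc i) + binomSub m (suc (suc k)) (suc i)
    ≡⟨ cong₂ _+_ (binomSub-suc m k i) (binomSub-suc m (suc k) i) ⟩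
  binomSub m k i + binomSub m (suc k) i
    ≡⟨ binomSub-pascal m k i ⟩
  binomSub (suc m) (suc k) i
    ≡⟨ sym (binomSub-suc (suc m) (suc k) i) ⟩
  binomSub (suc m) (suc (suc k)) (suc i) ∎
  where open ≡-Reasoning

card-heavy-small : k < 2 → card (heavy n k r) ≡ 0
card-heavy-small {n = n} {r} k<2 = card-empty {n} λ A p → let size , many = ∋-heavy A p in
  <⇒≱ k<2 (≤-trans many (≤-trans (prefix≤∣∣ r A) (≤-reflexive size)))

-- The term `i = j + 2` of `bound`: the number of `k`-sets with exactly `j + 2` points in `[ℓ+1]`
-- when `m` points lie beyond.
heavy-summand : ℕ → ℕ → ℕ → ℕ → ℕ
heavy-summand ℓ m k j = ((ℓ + 1) C (j + 2)) * binomSub m k (j + 2)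

-- Induction on the number `m` of points beyond the prefix, applying Pascal's rule to each summand.
-- At `m = 0` every point is in the prefix, so the single term `i = k` suffices.
card-heavy : ∀ m k ℓ → card (heavy (m + (ℓ + 1)) k (ℓ + 1)) ≤ sum (map (heavy-summand ℓ m k) (upTo ℓ))
card-heavy m zero ℓ = ≤-trans (≤-reflexive (card-heavy-small {n = m + (ℓ + 1)} z<s)) z≤n
card-heavy zero (suc zero) ℓ = ≤-trans (≤-reflexive (card-heavy-small {n = ℓ + 1} (s<s z<s))) z≤n
card-heavy zero (suc (suc j)) ℓ = begin
  card (heavy (ℓ + 1) (2 + j) (ℓ + 1))  ≤⟨ card-mono {ℓ + 1} (λ A p → level-∋ A (proj₁ (∋-heavy A p))) ⟩
  card (level (ℓ + 1) (2 + j))          ≤⟨ card-level (ℓ + 1) (2 + j) ⟩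
  (ℓ + 1) C (2 + j)                     ≤⟨ top-binomial ⟩
  sum (map f (upTo ℓ))                  ∎
  where
  open ≤-Reasoning
  f = heavy-summand ℓ 0 (2 + j)
  top-binomial : (ℓ + 1) C (2 + j) ≤ sum (map f (upTo ℓ))
  top-binomial with j <? ℓ
  -- Here the size `j + 2` exceeds the ground set of `ℓ + 1` points.
  ... | no j≮ℓ = ≤-trans (≤-reflexive (k>n⇒nCk≡0 (s≤s (subst (_≤ suc j) (+-comm 1 ℓ) (s≤s (≮⇒≥ j≮ℓ)))))) z≤n
  ... | yes j<ℓ = begin
    (ℓ + 1) C (2 + j)
      ≡⟨ sym (*-identityʳ _) ⟩
    ((ℓ + 1) C (2 + j)) * 1
      ≡⟨ cong (((ℓ + 1) C (2 + j)) *_) (sym (binomSub-diagonal 0 (2 + j))) ⟩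
    ((ℓ + 1) C (2 + j)) * binomSub 0 (2 + j) (2 + j)
      ≡⟨ cong (λ i → ((ℓ + 1) C i) * binomSub 0 (2 + j) i) (+-comm 2 j) ⟩
    f j
      ≤⟨ term≤sum f (∈-upTo⁺ j<ℓ) ⟩
    sum (map f (upTo ℓ)) ∎
card-heavy (suc m) (suc k) ℓ = begin
  card H
    ≡⟨ card-slice H ⟩
  card (slice true H) + card (slice false H)
    ≤⟨ +-mono-≤ (card-mono slice-true) (card-mono slice-false) ⟩
  card (heavy N k s) + card (heavy N (suc k) s)
    ≤⟨ +-mono-≤ (card-heavy m k ℓ) (card-heavy m (suc k) ℓ) ⟩
  sum (map (heavy-summand ℓ m k) (upTo ℓ)) + sum (map (heavy-summand ℓ m (suc k)) (upTo ℓ))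
    ≡⟨ sym (sum-+ (heavy-summand ℓ m k) (heavy-summand ℓ m (suc k)) (upTo ℓ)) ⟩
  sum (map (λ j → heavy-summand ℓ m k j + heavy-summand ℓ m (suc k) j) (upTo ℓ))
    ≤⟨ sum-mono (λ j → ≤-reflexive (pascal j)) (upTo ℓ) ⟩
  sum (map (heavy-summand ℓ (suc m) (suc k)) (upTo ℓ)) ∎
  where
  open ≤-Reasoning
  s = ℓ + 1
  N = m + s
  H = heavy (suc N) (suc k) s
  s≤n : s ≤ N
  s≤n = m≤n+m s m
  pascal : ∀ j → heavy-summand ℓ m k j + heavy-summand ℓ m (suc k) j ≡ heavy-summand ℓ (suc m) (suc k) j
  pascal j = trans (sym (*-distribˡ-+ (s C (j + 2)) _ _)) (cong ((s C (j + 2)) *_) (binomSub-pascal m k (j + 2)))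
  slice-true : ∀ A → slice true H ∋ A → heavy N k s ∋ A
  slice-true A p with ∋-heavy (A ∷ʳ true) p
  ... | size , many = heavy-∋ A (suc-injective (trans (sym (∣∷ʳ∣-true A)) size))
                                (subst (2 ≤_) (prefix-∷ʳ s A true s≤n) many)
  slice-false : ∀ A → slice false H ∋ A → heavy N (suc k) s ∋ A
  slice-false A p with ∋-heavy (A ∷ʳ false) p
  ... | size , many = heavy-∋ A (trans (sym (∣∷ʳ∣-false A)) size)
                                (subst (2 ≤_) (prefix-∷ʳ s A false s≤n) many)

-- Consequences of non-triviality.

-- The whole ground set if that has fewer than m elements.
first : ℕ → Subset n
first {zero}  _       = []
first {suc n} zero    = false ∷ first zero
first {suc n} (suc m) = true ∷ first m

-- Swaps starting at the far end turn `[m+1]` into `[2, m+2]`; `m < n` leaves room for the final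
-- point.
first-shift : ∀ {n m} → m < n → true ∷ first {n} m ⊑ false ∷ first (suc m)
first-shift {suc n} {zero}  _         = ⊑-swap (first 0)
first-shift {suc n} {suc m} (s≤s m<n) = ⊑-trans (⊑-∷ true (first-shift m<n)) (⊑-swap (first (suc m)))

first-⊑ : (A : Subset n) → first ∣ A ∣ ⊑ A
first-⊑ []          = ⊑-refl
first-⊑ (true ∷ A)  = ⊑-∷ true (first-⊑ A)
first-⊑ (false ∷ A) with ∣ A ∣ | first-⊑ A | ∣p∣≤n A
... | zero  | p | _   = ⊑-∷ false p
... | suc m | p | m<n = ⊑-trans (first-shift m<n) (⊑-∷ false p)

prefix≡0⇒Disjoint : ∀ s (A : Subset n) → prefix s A < 1 → Disjoint A (first s)
prefix≡0⇒Disjoint s       []          _        = []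
prefix≡0⇒Disjoint zero    (true ∷ A)  _        = left (prefix≡0⇒Disjoint 0 A z<s)
prefix≡0⇒Disjoint zero    (false ∷ A) _        = neither (prefix≡0⇒Disjoint 0 A z<s)
prefix≡0⇒Disjoint (suc s) (true ∷ A)  (s≤s ())
prefix≡0⇒Disjoint (suc s) (false ∷ A) lt       = right (prefix≡0⇒Disjoint s A lt)

-- `C` is the prefix with one point left out: the point where `A` meets it, or its last point if
-- there is none. Leaving out the first point instead gives the upper bound on `C`.
avoiding : ∀ ℓ (A : Subset (suc n)) → prefix (suc ℓ) A < 2 →
           ∃ λ C → C ⊑ false ∷ first ℓ × Disjoint A C
avoiding ℓ       (true ∷ A)      lt = _ , ⊑-refl , left (prefix≡0⇒Disjoint ℓ A (s≤s⁻¹ lt))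
avoiding zero    (false ∷ A)     lt = _ , ⊑-refl , neither (prefix≡0⇒Disjoint 0 A z<s)
avoiding (suc ℓ) (false ∷ [])    lt = _ , ⊑-refl , neither []
avoiding (suc ℓ) (false ∷ b ∷ A) lt with avoiding ℓ (b ∷ A) lt
... | C , p , d = true ∷ C , ⊑-trans (⊑-∷ true p) (⊑-swap (first ℓ)) , right d

nontrivial⇒MeetsPrefix : {F G : Family n} → 0 < n → Uniform ℓ G → NonTrivial G → DownClosed G →
                         (∀ {A B} → F ∋ A → G ∋ B → ¬ Disjoint A B) → MeetsPrefix (suc ℓ) F
nontrivial⇒MeetsPrefix {suc n} _ uniform nontrivial down cross A f with nontrivial fzero
... | true ∷ B  , g , 0∉B = contradiction here 0∉B
... | false ∷ B , g , 0∉B with uniform (false ∷ B) g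
-- `B` misses the first point, so it shifts down to `[2, ℓ+1]` and further to a member of `G`
-- disjoint from `A`.
...   | refl = ≮⇒≥ λ lt → let C , p , d = avoiding ∣ B ∣ A lt in
        cross f (down (⊑-trans p (⊑-∷ false (first-⊑ B))) g) d

-- Assembling the bound.

shifted⇒DownClosed : {F : Family n} → Uniform k F → Shifted k F → DownClosed F
shifted⇒DownClosed uniform shifted {A} {B} p f =
  shifted A B (trans (⊑-∣∣ p) (uniform B f)) (uniform B f) (⊑⇒≺ p) f

[1+n]Cn≡1+n : ∀ n → suc n C n ≡ suc n
[1+n]Cn≡1+n n = trans (nCk≡nC[n∸k] (n≤1+n n)) (trans (cong (suc n C_) (m+n∸n≡m 1 n)) (nC1≡n (suc n)))

theorem3p3 : (n k ℓ : ℕ) → ℓ ≤ k → 2 ≤ ℓ → k + ℓ ≤ n →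
    (F G : Family n) →
    Uniform k F → Uniform ℓ G →
    NonTrivial F → NonTrivial G →
    Shifted k F → Shifted ℓ G →
    CrossIntersecting F G →
    card F + card G ≤ bound n k ℓ
theorem3p3 n (suc a) ℓ@(suc b) (s≤s b≤a) _ k+ℓ≤n F G uF uG ntF ntG shF shG cross = begin
  card F + card G
    -- The excess is taken over `a + s`, which equals `k + ℓ`.
    ≤⟨ estimate (n ∸ (a + s)) (m∸n+n≡m a+s≤n) mF mG c ⟩
  card (heavy n (suc a) s) + s
    ≤⟨ +-mono-≤ (subst₂ (λ n′ s′ → card (heavy n′ (suc a) s′) ≤ main-term) n-split (+-comm ℓ 1)
                  (card-heavy (n ∸ ℓ ∸ 1) (suc a) ℓ))
                -- The extra `ℓ + 1` is the isolated last binomial of `bound`.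
                (≤-reflexive (sym (subst (λ s′ → s′ C ℓ ≡ s) (+-comm 1 ℓ) ([1+n]Cn≡1+n ℓ)))) ⟩
  bound n (suc a) ℓ ∎
  where
  open ≤-Reasoning
  s = suc ℓ
  main-term = sum (map (heavy-summand ℓ (n ∸ ℓ ∸ 1) (suc a)) (upTo ℓ))
  downF = shifted⇒DownClosed uF shF
  downG = shifted⇒DownClosed uG shG
  crossFG : ∀ {A B} → F ∋ A → G ∋ B → ¬ Disjoint A B
  crossFG {A} {B} f g d = Disjoint⇒Empty d (cross A B f g)
  c : Configuration n (suc a) ℓ F G
  c = record { uniformˡ = uF ; uniformʳ = uG ; downClosed = downF ; cross = crossFG }
  a+s≤n : a + s ≤ n
  a+s≤n = ≤-trans (≤-reflexive (+-suc a ℓ)) k+ℓ≤n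
  n-split : n ∸ ℓ ∸ 1 + (ℓ + 1) ≡ n
  n-split = trans (cong (_+ (ℓ + 1)) (∸-+-assoc n ℓ 1))
    (m∸n+n≡m (≤-trans (≤-reflexive (+-comm ℓ 1)) (≤-trans (m≤n+m s a) a+s≤n)))
  mF : MeetsPrefix s F
  mF = nontrivial⇒MeetsPrefix (≤-trans z<s k+ℓ≤n) uG ntG downG crossFG
  mG : MeetsPrefix (suc (suc a)) G
  mG = nontrivial⇒MeetsPrefix (≤-trans z<s k+ℓ≤n) uF ntF downF (λ g f d → crossFG f g (Disjoint-sym d))
  -- The ground set is generalised so that matching on `refl` can turn its size into the sum
  -- required by `meets-prefix-bound`.
  estimate : ∀ m {n} {F G : Family n} → m + (a + s) ≡ n →
    MeetsPrefix s F → MeetsPrefix (suc (suc a)) G → Configuration n (suc a) ℓ F G →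
    card F + card G ≤ card (heavy n (suc a) s) + s
  estimate m refl = meets-prefix-bound m a b b≤a
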